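{- Let $n$ be a positive integer and let $i,j$ be non-negative integers. Then $$f_{n+i+1}\, f^{(i+1)}_{n+j+1} = f_{n+i+j+2}\, f^{(i+1)}_{n} + (-1)^n\, w_{i+1}w_{i+2}\cdots w_{i+n}\, f_{i+1}\, f^{(n+i+1)}_{j+1}.$$
   Context: Let $(w_n)_{n\ge 0}$ be a sequence of commuting indeterminates (called weights). The weighted Fibonacci numbers $f_n$ ($n\ge 0$) are defined by $f_0=0$, $f_1=1$ and $f_{n+2}=f_{n+1}+w_n f_n$ for $n\ge 0$. For each integer $m\ge 0$, the weighted $m$-shifted Fibonacci numbers $f^{(m)}_n$ ($n\ge 0$) are defined by $f^{(m)}_0=0$, $f^{(m)}_1=1$ and $f^{(m)}_{n+2}=f^{(m)}_{n+1}+w_{n+m} f^{(m)}_n$ for $n\ge 0$. The superscript $(m)$ is an index, not a power or a derivative. Both are polynomials in the weights with integer coefficients. -}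

module Defs where

open import Algebra.Bundles using (CommutativeRing; Semiring)
open import Data.Fin.Base using (toℕ)
open import Data.Nat.Base as ℕ using (ℕ; zero; suc)
import Algebra.Definitions.RawSemiring as RawSemiringDefinitions

-- The weights range over arbitrary sequences in an arbitrary commutative
-- ring.  The case of indeterminates is R = ℤ[w₀, w₁, …] with w the sequence of
-- its generators; conversely an identity between integer polynomials in the
-- indeterminates specialises to every such R and w.
module WeightedFibonacci
  {c ℓ} (R : CommutativeRing c ℓ) (w : ℕ → CommutativeRing.Carrier R) where

  open CommutativeRing R using (Carrier; _+_; _*_; 0#; 1#; semiring)
  open RawSemiringDefinitions (Semiring.rawSemiring semiring) public using (_^_)
  open RawSemiringDefinitions (Semiring.rawSemiring semiring) using (product)

  f : ℕ → Carrier
  f zero          = 0#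
  f (suc zero)    = 1#
  f (suc (suc n)) = f (suc n) + w n * f n

  -- f⟨ m ⟩ n is f⁽ᵐ⁾ₙ: the shift m is an index, not a power.
  f⟨_⟩ : ℕ → ℕ → Carrier
  f⟨ m ⟩ zero          = 0#
  f⟨ m ⟩ (suc zero)    = 1#
  f⟨ m ⟩ (suc (suc n)) = f⟨ m ⟩ (suc n) + w (n ℕ.+ m) * f⟨ m ⟩ n

  -- wᵢ₊₁ wᵢ₊₂ ⋯ wᵢ₊ₙ  (the k-th factor, counting from 0, is wᵢ₊₁₊ₖ)
  weightProduct : (i n : ℕ) → Carrier
  weightProduct i n = product {n} λ k → w (i ℕ.+ 1 ℕ.+ toℕ k)

{-# OPTIONS --safe #-}
module Submission where

open import Defs
open import Algebra.Bundles using (CommutativeRing)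
open import Data.Fin.Base using (toℕ)
open import Data.Fin.Properties using (toℕ-fromℕ; toℕ-inject₁)
open import Data.Nat.Base as ℕ using (ℕ; zero; suc; NonZero)
open import Data.Nat.Properties using (+-assoc; +-comm)
open import Data.Nat.Tactic.RingSolver using (solve-∀)
open import Relation.Binary.PropositionalEquality.Core as ≡ using (_≡_)
import Algebra.Properties.Monoid.Sum as MonoidSum
import Algebra.Solver.Ring.NaturalCoefficients.Default as SemiringSolver
import Relation.Binary.Reasoning.Setoid as SetoidReasoning

-- The sequences k ↦ f_{k+m} and f⁽ᵐ⁾ satisfy the same second-order recurrence.
-- Their Casoratian is multiplied by -w_{n+m} when n increases by one, which
-- gives the identity for consecutive indices.  With n fixed, both sides of the
-- general identity satisfy the recurrence shifted by n + m as sequences in the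
-- remaining index, so it suffices to compare their first two terms.

module Recurrence
  {c ℓ} (R : CommutativeRing c ℓ) (w : ℕ → CommutativeRing.Carrier R) where

  open CommutativeRing R hiding (+-assoc; +-comm)
  open WeightedFibonacci R w
  open SetoidReasoning setoid
  open SemiringSolver commutativeSemiring using (solve; _:=_; _:+_; _:*_; con)
  open MonoidSum *-monoid using () renaming
    (sum-init-last to product-init-last; sum-cong-≗ to product-cong-≗)

  IsSolution : ℕ → (ℕ → Carrier) → Set ℓ
  IsSolution m x = ∀ k → x (2 ℕ.+ k) ≈ x (1 ℕ.+ k) + w (k ℕ.+ m) * x k

  -- With the variable to the left of the shift, `2 ℕ.+ k ℕ.+ m` reduces to two successors, so the
  -- recurrence of `f` unfolds definitionally.
  f-isSolution : ∀ m → IsSolution m (λ k → f (k ℕ.+ m))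
  f-isSolution m k = refl

  f⟨⟩-isSolution : ∀ m → IsSolution m f⟨ m ⟩
  f⟨⟩-isSolution m k = refl

  -- Moving the argument by `n` moves the weights with it. This is where the shift `n ℕ.+ (i ℕ.+ 1)`
  -- of the last factor in the theorem comes from.
  shift-isSolution : ∀ {m x} n → IsSolution m x → IsSolution (n ℕ.+ m) (λ k → x (k ℕ.+ n))
  shift-isSolution {m} {x} n sol k =
    ≡.subst (λ l → x (2 ℕ.+ k ℕ.+ n) ≈ x (1 ℕ.+ k ℕ.+ n) + w l * x (k ℕ.+ n))
            (+-assoc k n m) (sol (k ℕ.+ n))

  *-isSolution : ∀ {m x} a → IsSolution m x → IsSolution m (λ k → a * x k)
  *-isSolution {m} {x} a sol k = trans (*-congˡ (sol k))
    (solve 4 (λ a p v q → a :* (p :+ v :* q) := a :* p :+ v :* (a :* q)) refl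
       a (x (1 ℕ.+ k)) (w (k ℕ.+ m)) (x k))

  +-isSolution : ∀ {m x y} → IsSolution m x → IsSolution m y → IsSolution m (λ k → x k + y k)
  +-isSolution {m} {x} {y} solx soly k = trans (+-cong (solx k) (soly k))
    (solve 5 (λ p v q r s → (p :+ v :* q) :+ (r :+ v :* s) := (p :+ r) :+ v :* (q :+ s)) refl
       (x (1 ℕ.+ k)) (w (k ℕ.+ m)) (x k) (y (1 ℕ.+ k)) (y k))

  solution-unique : ∀ {m x y} → IsSolution m x → IsSolution m y →
                    x 0 ≈ y 0 → x 1 ≈ y 1 → ∀ k → x k ≈ y k
  solution-unique solx soly x₀≈y₀ x₁≈y₁ zero          = x₀≈y₀
  solution-unique solx soly x₀≈y₀ x₁≈y₁ (suc zero)    = x₁≈y₁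
  solution-unique {m} {x} {y} solx soly x₀≈y₀ x₁≈y₁ (suc (suc k)) = begin
    x (2 ℕ.+ k)                        ≈⟨ solx k ⟩
    x (1 ℕ.+ k) + w (k ℕ.+ m) * x k    ≈⟨ +-cong (x≈y (suc k)) (*-congˡ (x≈y k)) ⟩
    y (1 ℕ.+ k) + w (k ℕ.+ m) * y k    ≈⟨ soly k ⟨
    y (2 ℕ.+ k)                        ∎
    where x≈y = solution-unique {m} {x} {y} solx soly x₀≈y₀ x₁≈y₁

  -- `product` unfolds from its first factor, whereas induction on `n` appends a last one. The index
  -- of that factor takes the form in which `IsSolution (i ℕ.+ 1)` supplies the weight at `n`.
  weightProduct-suc : ∀ i n → weightProduct i (suc n) ≈ weightProduct i n * w (n ℕ.+ (i ℕ.+ 1))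
  weightProduct-suc i n = trans (product-init-last {n} λ k → w (i ℕ.+ 1 ℕ.+ toℕ k))
    (reflexive (≡.cong₂ _*_
      (product-cong-≗ {n} λ k → ≡.cong (λ l → w (i ℕ.+ 1 ℕ.+ l)) (toℕ-inject₁ k))
      (≡.cong w (≡.trans (≡.cong (i ℕ.+ 1 ℕ.+_) (toℕ-fromℕ n)) (+-comm (i ℕ.+ 1) n)))))

  -- If xₙ = a, xₙ₊₁ = b, yₙ = c and yₙ₊₁ = d, the Casoratian passes from q to -v q.
  casoratian-step : ∀ {a b c d q} v → a * d ≈ b * c + q →
                    b * (d + v * c) ≈ (b + v * a) * d + - 1# * (q * v)
  casoratian-step {a} {b} {c} {d} {q} v ad≈bc+q = begin
    b * (d + v * c)
      ≈⟨ +-identityʳ _ ⟨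
    b * (d + v * c) + 0#
      -- The semiring solver has no negation. Inserting `0#` as `(1# + - 1#) * (q * v)` leaves an
      -- identity that holds with `- 1#` replaced by an atom `e`.
      ≈⟨ +-congˡ (trans (*-congʳ (-‿inverseʳ 1#)) (zeroˡ (q * v))) ⟨
    b * (d + v * c) + (1# + - 1#) * (q * v)
      ≈⟨ solve 6 (λ b c d q v e → b :* (d :+ v :* c) :+ (con 1 :+ e) :* (q :* v)
                   := b :* d :+ v :* (b :* c :+ q) :+ e :* (q :* v)) refl b c d q v (- 1#) ⟩
    b * d + v * (b * c + q) + - 1# * (q * v)
      ≈⟨ +-congʳ (+-congˡ (*-congˡ ad≈bc+q)) ⟨
    b * d + v * (a * d) + - 1# * (q * v)
      ≈⟨ +-congʳ (solve 4 (λ a b d v → b :* d :+ v :* (a :* d) := (b :+ v :* a) :* d) refl a b d v) ⟩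
    (b + v * a) * d + - 1# * (q * v)
      ∎

  casoratian : ∀ {x} i → IsSolution (i ℕ.+ 1) x → let y = f⟨ i ℕ.+ 1 ⟩ in
               ∀ n → x n * y (suc n) ≈ x (suc n) * y n + (- 1#) ^ n * weightProduct i n * x 0
  -- As `y 0` is `0#` and `y 1` is `1#`, the Casoratian starts at `x 0`, the source of the constant
  -- factor on the right.
  casoratian {x} i sol zero =
    solve 2 (λ a b → a :* con 1 := b :* con 0 :+ con 1 :* con 1 :* a) refl (x 0) (x 1)
  casoratian {x} i sol (suc n) = begin
    x (suc n) * y (suc (suc n))
      ≈⟨ casoratian-step v (casoratian i sol n) ⟩
    (x (suc n) + v * x n) * y (suc n) + - 1# * (s * p * x 0 * v)
      ≈⟨ +-cong (*-congʳ (sym (sol n)))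
           (solve 5 (λ e s p z v → e :* (s :* p :* z :* v) := e :* s :* (p :* v) :* z) refl
              (- 1#) s p (x 0) v) ⟩
    x (suc (suc n)) * y (suc n) + - 1# * s * (p * v) * x 0
      ≈⟨ +-congˡ (*-congʳ (*-congˡ (weightProduct-suc i n))) ⟨
    x (suc (suc n)) * y (suc n) + - 1# * s * weightProduct i (suc n) * x 0
      ∎
    where
    y = f⟨ i ℕ.+ 1 ⟩
    v = w (n ℕ.+ (i ℕ.+ 1))
    s = (- 1#) ^ n
    p = weightProduct i n

  casoratian-gap : ∀ {x} i → IsSolution (i ℕ.+ 1) x → let y = f⟨ i ℕ.+ 1 ⟩ in
    ∀ n j → x n * y (j ℕ.+ n) ≈
            y n * x (j ℕ.+ n) + (- 1#) ^ n * weightProduct i n * x 0 * f⟨ n ℕ.+ (i ℕ.+ 1) ⟩ j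
  casoratian-gap {x} i sol n = solution-unique {m}
    (*-isSolution {m} (x n) (shift-isSolution {x = y} n (f⟨⟩-isSolution (i ℕ.+ 1))))
    (+-isSolution {m} (*-isSolution {m} (y n) (shift-isSolution {x = x} n sol))
                      (*-isSolution {m} q (f⟨⟩-isSolution m)))
    -- At `j = 0` the term in `q` vanishes and both sides are `x n * y n` up to order. At `j = 1`
    -- its last factor is `1#`, and the claim is `casoratian`.
    (solve 3 (λ a b q → a :* b := b :* a :+ q :* con 0) refl (x n) (y n) q)
    (trans (casoratian i sol n) (+-cong (*-comm _ _) (sym (*-identityʳ q))))
    where
    m = n ℕ.+ (i ℕ.+ 1)
    y = f⟨ i ℕ.+ 1 ⟩
    q = (- 1#) ^ n * weightProduct i n * x 0

n+j+1≡j+1+n : ∀ n j → n ℕ.+ j ℕ.+ 1 ≡ j ℕ.+ 1 ℕ.+ n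
n+j+1≡j+1+n = solve-∀

n+i+j+2≡j+1+n+i+1 : ∀ n i j → n ℕ.+ i ℕ.+ j ℕ.+ 2 ≡ j ℕ.+ 1 ℕ.+ n ℕ.+ (i ℕ.+ 1)
n+i+j+2≡j+1+n+i+1 = solve-∀

theorem4 : ∀ {c ℓ} (R : CommutativeRing c ℓ) (w : ℕ → CommutativeRing.Carrier R) →
    let open CommutativeRing R
        open WeightedFibonacci R w
    in (n i j : ℕ) → .{{_ : NonZero n}} →
       f (n ℕ.+ i ℕ.+ 1) * f⟨ i ℕ.+ 1 ⟩ (n ℕ.+ j ℕ.+ 1)
         ≈ f (n ℕ.+ i ℕ.+ j ℕ.+ 2) * f⟨ i ℕ.+ 1 ⟩ n
           + (- 1#) ^ n * weightProduct i n * f (i ℕ.+ 1) * f⟨ n ℕ.+ i ℕ.+ 1 ⟩ (j ℕ.+ 1)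
theorem4 R w n i j
  -- Every index is brought to the form variable plus shift, with `j ℕ.+ 1` as the gap.
  rewrite +-assoc n i 1 | n+j+1≡j+1+n n j | n+i+j+2≡j+1+n+i+1 n i j = begin
    f (n ℕ.+ (i ℕ.+ 1)) * f⟨ i ℕ.+ 1 ⟩ (j ℕ.+ 1 ℕ.+ n)
      -- Here `x k` is `f (k ℕ.+ (i ℕ.+ 1))`, so `x 0` is the factor `f (i ℕ.+ 1)`.
      ≈⟨ casoratian-gap i (f-isSolution (i ℕ.+ 1)) n (j ℕ.+ 1) ⟩
    f⟨ i ℕ.+ 1 ⟩ n * f (j ℕ.+ 1 ℕ.+ n ℕ.+ (i ℕ.+ 1)) + q
      ≈⟨ +-congʳ (*-comm _ _) ⟩
    f (j ℕ.+ 1 ℕ.+ n ℕ.+ (i ℕ.+ 1)) * f⟨ i ℕ.+ 1 ⟩ n + q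
      ∎
  where
  open CommutativeRing R hiding (+-assoc)
  open WeightedFibonacci R w
  open Recurrence R w
  open SetoidReasoning setoid

  q = (- 1#) ^ n * weightProduct i n * f (i ℕ.+ 1) * f⟨ n ℕ.+ (i ℕ.+ 1) ⟩ (j ℕ.+ 1)
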